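{- Work in constructive type theory (as in Coq). Let $\mathsf{Halt}$ be the halting problem for multi-tape Turing machines: its instances are tuples $(\Sigma,n,M,tp)$ consisting of a finite alphabet $\Sigma$, a number of tapes $n$, an $n$-tape Turing machine $M$ over $\Sigma$, and a vector $tp$ of $n$ tapes over $\Sigma$, and $\mathsf{Halt}(\Sigma,n,M,tp)$ holds iff there are a configuration $c$ of $M$ whose state is a halting state and a number $k$ such that $\mathsf{loopM}\,(\mathsf{start}\,M,tp)\,k=\mathsf{Some}\,c$. Then $\mathsf{Halt}\preceq\mathcal{E}$, i.e. there is a function $g$ from such tuples to $\mathbf{T}$ with $\mathsf{Halt}(x)\leftrightarrow\mathcal{E}(g\,x)$ for all instances $x$.
   Context: Turing machines follow Asperti and Ricciotti: an $n$-tape machine $M$ over a finite alphabet $\Sigma$ has a finite set of states, a start state $\mathsf{start}\,M$, a boolean halting predicate on states, and a transition function mapping a state and the vector of the $n$ currently read symbols (each an element of $\mathsf{option}\,\Sigma$) to a new state and, for each tape, an action (an optional symbol to write and a move left, right, or none). A tape is one of: empty, left-of (a symbol and the list to its right), right-of (a symbol and the list to its left), or mid-tape (left list, current symbol, right list). A configuration is a pair of a state and a vector of $n$ tapes. $\mathsf{loopM}\,c\,k$ runs $M$ from configuration $c$ for at most $k$ transition steps, returning $\mathsf{Some}\,c'$ for the first configuration $c'$ reached (including $c$ itself) whose state is halting, and $\mathsf{None}$ if none is reached within $k$ steps. The weak call-by-value $\lambda$-calculus L has terms $\mathbf{T}$ given by $s,t ::= n \mid s\,t \mid \lambda s$ (de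 Bruijn indices). Substitution $s[k:=u]$: $k[k:=u]=u$, $n[k:=u]=n$ for $n\neq k$, $(st)[k:=u]=(s[k:=u])(t[k:=u])$, $(\lambda s)[k:=u]=\lambda(s[k+1:=u])$. Reduction $\succ$ is the least relation with $(\lambda s)(\lambda t)\succ s[0:=\lambda t]$, $s\succ s' \Rightarrow st\succ s't$, $t\succ t'\Rightarrow st\succ st'$; $\succ^*$ is its reflexive transitive closure. $\mathcal{E}(s)$ means: there is $v$ with $s\succ^* v$ and $v$ an abstraction. -}

module Defs where

open import Data.Nat using (ℕ; zero; suc; _≡ᵇ_)
open import Data.Bool using (Bool; true; false; if_then_else_)
open import Data.List using (List; []; _∷_)
open import Data.Maybe using (Maybe; just; nothing)
open import Data.Vec using (Vec; map; zipWith)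
open import Data.Product using (Σ; Σ-syntax; ∃; _×_; _,_; proj₁; proj₂)
open import Data.List.Membership.Propositional using (_∈_)
open import Relation.Binary.PropositionalEquality using (_≡_)
open import Relation.Binary.Definitions using (DecidableEquality)

-- Finite types (as Coq's finType: decidable equality + complete enumeration)

record FinType : Set₁ where
  field
    Carrier  : Set
    _≟_      : DecidableEquality Carrier
    enum     : List Carrier
    complete : ∀ x → x ∈ enum
open FinType public

-- Tapes and Turing machines (Asperti–Ricciotti style)

data Tape (A : Set) : Set where
  niltape : Tape A
  leftof  : A → List A → Tape A
  rightof : A → List A → Tape A
  midtape : List A → A → List A → Tape A

data Move : Set where
  L R N : Move

module _ {A : Set} where
  current : Tape A → Maybe A
  current (midtape _ c _) = just c
  current _               = nothing

  left : Tape A → List A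
  left niltape         = []
  left (leftof _ _)    = []
  left (rightof s l)   = s ∷ l
  left (midtape l _ _) = l

  right : Tape A → List A
  right niltape         = []
  right (leftof s r)    = s ∷ r
  right (rightof _ _)   = []
  right (midtape _ _ r) = r

  tape-move-right' : List A → A → List A → Tape A
  tape-move-right' ls a []        = rightof a ls
  tape-move-right' ls a (r ∷ rs)  = midtape (a ∷ ls) r rs

  tape-move-right : Tape A → Tape A
  tape-move-right niltape            = niltape
  tape-move-right (rightof a l)      = rightof a l
  tape-move-right (leftof a rs)      = midtape [] a rs
  tape-move-right (midtape ls a rs)  = tape-move-right' ls a rs

  tape-move-left' : List A → A → List A → Tape A
  tape-move-left' []       a rs = leftof a rs
  tape-move-left' (l ∷ ls) a rs = midtape ls l (a ∷ rs)

  tape-move-left : Tape A → Tape A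
  tape-move-left niltape           = niltape
  tape-move-left (leftof a rs)     = leftof a rs
  tape-move-left (rightof a ls)    = midtape ls a []
  tape-move-left (midtape ls a rs) = tape-move-left' ls a rs

  tape-move : Tape A → Move → Tape A
  tape-move t L = tape-move-left t
  tape-move t R = tape-move-right t
  tape-move t N = t

  tape-write : Tape A → Maybe A → Tape A
  tape-write t nothing  = t
  tape-write t (just s) = midtape (left t) s (right t)

  doAct : Tape A → Maybe A × Move → Tape A
  doAct t (s , m) = tape-move (tape-write t s) m

record TM (Σ' : FinType) (n : ℕ) : Set₁ where
  field
    states : FinType
    trans  : Carrier states × Vec (Maybe (Carrier Σ')) n
             → Carrier states × Vec (Maybe (Carrier Σ') × Move) n
    start  : Carrier states
    halt   : Carrier states → Bool
open TM public

Conf : {Σ' : FinType} {n : ℕ} → TM Σ' n → Set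
Conf {Σ'} {n} M = Carrier (states M) × Vec (Tape (Carrier Σ')) n

step : {Σ' : FinType} {n : ℕ} (M : TM Σ' n) → Conf M → Conf M
step M (q , t) with trans M (q , map current t)
... | (q' , act) = q' , zipWith doAct t act

loop : {A : Set} → (A → A) → (A → Bool) → A → ℕ → Maybe A
loop f p a k with p a
... | true = just a
loop f p a zero    | false = nothing
loop f p a (suc k) | false = loop f p (f a) k

loopM : {Σ' : FinType} {n : ℕ} (M : TM Σ' n) → Conf M → ℕ → Maybe (Conf M)
loopM M c k = loop (step M) (λ c' → halt M (proj₁ c')) c k

HaltInstance : Set₁
HaltInstance = Σ[ Σ' ∈ FinType ] Σ[ n ∈ ℕ ] Σ[ M ∈ TM Σ' n ] Vec (Tape (Carrier Σ')) n

Halt : HaltInstance → Set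
Halt (Σ' , n , M , tp) =
  Σ[ c ∈ Conf M ] Σ[ k ∈ ℕ ] (halt M (proj₁ c) ≡ true) × (loopM M (start M , tp) k ≡ just c)

data Term : Set where
  var : ℕ → Term
  app : Term → Term → Term
  lam : Term → Term

subst : Term → ℕ → Term → Term
subst (var n) k u = if n ≡ᵇ k then u else var n
subst (app s t) k u = app (subst s k u) (subst t k u)
subst (lam s) k u = lam (subst s (suc k) u)

infix 4 _≻_ _≻*_
data _≻_ : Term → Term → Set where
  stepβ : ∀ {s t} → app (lam s) (lam t) ≻ subst s 0 (lam t)
  stepAppL : ∀ {s s' t} → s ≻ s' → app s t ≻ app s' t
  stepAppR : ∀ {s t t'} → t ≻ t' → app s t ≻ app s t'

data _≻*_ : Term → Term → Set where
  refl* : ∀ {s} → s ≻* s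
  step* : ∀ {s t u} → s ≻ t → t ≻* u → s ≻* u

isLam : Term → Set
isLam s = Σ[ s' ∈ Term ] s ≡ lam s'

E : Term → Set
E s = Σ[ v ∈ Term ] (s ≻* v) × isLam v

-- Given a machine M and start tapes, we build an L term  D D ⌜c⌝  (D a
-- self-application combinator, ⌜c⌝ the Scott encoding of a configuration)
-- that evaluates one machine step per round and reduces to the identity
-- exactly when the machine halts.  Iterating gives soundness; the step
--     count invariance gives completeness, by induction on that count.
--   * The reduction function and the main theorem.
module Submission where

open import Defs
open import Data.Product using (Σ-syntax; _×_; _,_; proj₁; proj₂)
open import Data.Nat using (ℕ; zero; suc; _≡ᵇ_; _<ᵇ_; _<_; _≤_; z≤n; s≤s; s≤s⁻¹)
open import Data.Nat.Properties using (<ᵇ⇒<; <-≤-trans; ≤-refl; ≤-trans; n≤1+n)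
open import Data.Bool using (Bool; true; false; T; if_then_else_; _∧_)
open import Data.Bool.Properties using (T-∧)
open import Data.Unit using (tt)
open import Data.Empty using (⊥-elim)
open import Data.Fin using (toℕ)
open import Data.Maybe using (Maybe; just; nothing)
open import Data.List using (List; []; _∷_; map)
open import Data.List.Relation.Unary.Any using (here; there; index)
open import Data.List.Membership.Propositional using (_∈_)
open import Data.Vec using (Vec; []; _∷_; zipWith) renaming (map to vmap)
open import Data.Sum using (_⊎_; inj₁; inj₂)
open import Function.Bundles using (Equivalence)
open import Relation.Nullary using (¬_)
open import Relation.Binary.PropositionalEquality using (_≡_; refl; sym; cong; cong₂)

≻*-trans : ∀ {s t u} → s ≻* t → t ≻* u → s ≻* u
≻*-trans refl*        q = q
≻*-trans (step* st p) q = step* st (≻*-trans p q)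

≻*-appˡ : ∀ {s s' t} → s ≻* s' → app s t ≻* app s' t
≻*-appˡ refl*        = refl*
≻*-appˡ (step* st p) = step* (stepAppL st) (≻*-appˡ p)

≻*-appʳ : ∀ {s t t'} → t ≻* t' → app s t ≻* app s t'
≻*-appʳ refl*        = refl*
≻*-appʳ (step* st p) = step* (stepAppR st) (≻*-appʳ p)

uniformConfluence : ∀ {s t₁ t₂} → s ≻ t₁ → s ≻ t₂ →
                    (t₁ ≡ t₂) ⊎ (Σ[ u ∈ Term ] (t₁ ≻ u) × (t₂ ≻ u))
uniformConfluence stepβ         stepβ         = inj₁ refl
uniformConfluence stepβ         (stepAppL ())
uniformConfluence stepβ         (stepAppR ())
uniformConfluence (stepAppL ()) stepβ
uniformConfluence (stepAppR ()) stepβ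
uniformConfluence (stepAppL p)  (stepAppR q)  = inj₂ (_ , stepAppR q , stepAppL p)
uniformConfluence (stepAppR p)  (stepAppL q)  = inj₂ (_ , stepAppL q , stepAppR p)
uniformConfluence (stepAppL p)  (stepAppL q) with uniformConfluence p q
... | inj₁ refl            = inj₁ refl
... | inj₂ (u , p' , q')   = inj₂ (app u _ , stepAppL p' , stepAppL q')
uniformConfluence (stepAppR p)  (stepAppR q) with uniformConfluence p q
... | inj₁ refl            = inj₁ refl
... | inj₂ (u , p' , q')   = inj₂ (app _ u , stepAppR p' , stepAppR q')

infix 4 _≻[_]_
data _≻[_]_ : Term → ℕ → Term → Set where
  done : ∀ {s} → s ≻[ 0 ] s
  _∷_  : ∀ {s t u n} → s ≻ t → t ≻[ n ] u → s ≻[ suc n ] u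

countSteps : ∀ {s t} → s ≻* t → Σ[ n ∈ ℕ ] s ≻[ n ] t
countSteps refl*        = 0 , done
countSteps (step* st p) = let n , q = countSteps p in suc n , st ∷ q

Normal : Term → Set
Normal u = ∀ {t} → ¬ (u ≻ t)

lam-normal : ∀ b → Normal (lam b)
lam-normal b ()

-- By uniform confluence, any step towards a normal form u reached in n
-- steps leaves exactly n - 1 steps.
stepToNormal : ∀ {s t u n} → Normal u → s ≻[ n ] u → s ≻ t →
               Σ[ m ∈ ℕ ] (n ≡ suc m) × (t ≻[ m ] u)
stepToNormal nf done       st = ⊥-elim (nf st)
stepToNormal nf (st₁ ∷ r)  st with uniformConfluence st₁ st
... | inj₁ refl              = _ , refl , r
... | inj₂ (w , st₁' , st')  with stepToNormal nf r st₁'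
...   | m , refl , r'        = suc m , refl , st' ∷ r'

reductToNormal : ∀ {s t u n} → Normal u → s ≻[ n ] u → s ≻* t →
                 Σ[ m ∈ ℕ ] (m ≤ n) × (t ≻[ m ] u)
reductToNormal nf r refl*        = _ , ≤-refl , r
reductToNormal nf r (step* st p) with stepToNormal nf r st
... | m , refl , r' with reductToNormal nf r' p
...   | k , k≤m , r'' = k , ≤-trans k≤m (n≤1+n m) , r''

properReductToNormal : ∀ {s t t' u n} → Normal u → s ≻[ n ] u → s ≻ t → t ≻* t' →
                       Σ[ m ∈ ℕ ] (m < n) × (t' ≻[ m ] u)
properReductToNormal nf r st p with stepToNormal nf r st
... | m , refl , r' with reductToNormal nf r' p
...   | k , k≤m , r'' = k , s≤s k≤m , r''

BoundBy : ℕ → Term → Set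
BoundBy d (var n)   = n < d
BoundBy d (app s t) = BoundBy d s × BoundBy d t
BoundBy d (lam s)   = BoundBy (suc d) s

boundBy-mono : ∀ {d e} s → d ≤ e → BoundBy d s → BoundBy e s
boundBy-mono (var n)   d≤e b         = <-≤-trans b d≤e
boundBy-mono (app s t) d≤e (bs , bt) = boundBy-mono s d≤e bs , boundBy-mono t d≤e bt
boundBy-mono (lam s)   d≤e b         = boundBy-mono s (s≤s d≤e) b

<⇒≡ᵇ-false : ∀ {n k} → n < k → (n ≡ᵇ k) ≡ false
<⇒≡ᵇ-false {zero}  {suc k} _       = refl
<⇒≡ᵇ-false {suc n} {suc k} (s≤s p) = <⇒≡ᵇ-false p

subst-boundBy : ∀ {d} s k u → BoundBy d s → d ≤ k → subst s k u ≡ s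
subst-boundBy (var n)   k u b d≤k rewrite <⇒≡ᵇ-false (<-≤-trans b d≤k) = refl
subst-boundBy (app s t) k u (bs , bt) d≤k =
  cong₂ app (subst-boundBy s k u bs d≤k) (subst-boundBy t k u bt d≤k)
subst-boundBy (lam s)   k u b d≤k = cong lam (subst-boundBy s (suc k) u b (s≤s d≤k))

-- Templates are L terms with embedded closed abstractions.  A value
-- abs B _  stands for the closed abstraction λB (closedness is checked by
-- computation).  Embedding it as ⟨ c ⟩ or ⟪ c ⟫ denotes the same L term;
-- the evaluator below applies ⟨ c ⟩ but treats an application of a frozen
-- ⟪ c ⟫ as stuck, so that such an application is handled by a lemma.
data Tm : Set
data Val : Set
boundByᵇ : ℕ → Tm → Bool

infixl 7 _·_
data Tm where
  v   : ℕ → Tm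
  _·_ : Tm → Tm → Tm
  ƛ   : Tm → Tm
  ⟨_⟩ : Val → Tm
  ⟪_⟫ : Val → Tm

data Val where
  abs : (B : Tm) → T (boundByᵇ 1 B) → Val

boundByᵇ d (v n)   = n <ᵇ d
boundByᵇ d (s · t) = boundByᵇ d s ∧ boundByᵇ d t
boundByᵇ d (ƛ s)   = boundByᵇ (suc d) s
boundByᵇ d ⟨ c ⟩   = true
boundByᵇ d ⟪ c ⟫   = true

⟦_⟧ : Tm → Term
body : Val → Term

⟦ v n ⟧   = var n
⟦ s · t ⟧ = app ⟦ s ⟧ ⟦ t ⟧
⟦ ƛ s ⟧   = lam ⟦ s ⟧
⟦ ⟨ c ⟩ ⟧ = lam (body c)
⟦ ⟪ c ⟫ ⟧ = lam (body c)

body (abs B _) = ⟦ B ⟧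

boundByᵇ-sound : ∀ d X → T (boundByᵇ d X) → BoundBy d ⟦ X ⟧
boundByᵇ-sound d (v n)   p = <ᵇ⇒< n d p
boundByᵇ-sound d (s · t) p =
  let ps , pt = Equivalence.to T-∧ p in boundByᵇ-sound d s ps , boundByᵇ-sound d t pt
boundByᵇ-sound d (ƛ s)   p = boundByᵇ-sound (suc d) s p
boundByᵇ-sound d ⟨ abs B q ⟩ p = boundBy-mono ⟦ B ⟧ (s≤s z≤n) (boundByᵇ-sound 1 B q)
boundByᵇ-sound d ⟪ abs B q ⟫ p = boundBy-mono ⟦ B ⟧ (s≤s z≤n) (boundByᵇ-sound 1 B q)

-- Substitution on templates; embedded values are closed, hence untouched.
substT : Tm → ℕ → Tm → Tm
substT (v n)   k U = if n ≡ᵇ k then U else v n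
substT (s · t) k U = substT s k U · substT t k U
substT (ƛ s)   k U = ƛ (substT s (suc k) U)
substT ⟨ c ⟩   k U = ⟨ c ⟩
substT ⟪ c ⟫   k U = ⟪ c ⟫

⟦⟧-substT : ∀ X k U → subst ⟦ X ⟧ k ⟦ U ⟧ ≡ ⟦ substT X k U ⟧
⟦⟧-substT (v n)   k U with n ≡ᵇ k
... | true  = refl
... | false = refl
⟦⟧-substT (s · t) k U = cong₂ app (⟦⟧-substT s k U) (⟦⟧-substT t k U)
⟦⟧-substT (ƛ s)   k U = cong lam (⟦⟧-substT s (suc k) U)
⟦⟧-substT ⟨ abs B p ⟩ k U =
  cong lam (subst-boundBy ⟦ B ⟧ (suc k) _ (boundByᵇ-sound 1 B p) (s≤s z≤n))
⟦⟧-substT ⟪ abs B p ⟫ k U =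
  cong lam (subst-boundBy ⟦ B ⟧ (suc k) _ (boundByᵇ-sound 1 B p) (s≤s z≤n))

asAbs : (X : Tm) → Maybe (Σ[ b ∈ Term ] ⟦ X ⟧ ≡ lam b)
asAbs (ƛ B)          = just (⟦ B ⟧ , refl)
asAbs ⟨ c ⟩          = just (body c , refl)
asAbs ⟪ c ⟫          = just (body c , refl)
asAbs _              = nothing

β-template : ∀ B U {b} → ⟦ U ⟧ ≡ lam b → app (lam ⟦ B ⟧) ⟦ U ⟧ ≻ ⟦ substT B 0 U ⟧
β-template B U eq rewrite sym (⟦⟧-substT B 0 U) | eq = stepβ

tryβ : (s t : Tm) → Maybe (Σ[ r ∈ Tm ] ⟦ s · t ⟧ ≻ ⟦ r ⟧)
tryβ (ƛ B)       t with asAbs t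
... | just (_ , eq) = just (substT B 0 t , β-template B t eq)
... | nothing       = nothing
tryβ ⟨ abs B _ ⟩ t = tryβ (ƛ B) t
tryβ _           _ = nothing

tryStep : (X : Tm) → Maybe (Σ[ Y ∈ Tm ] ⟦ X ⟧ ≻ ⟦ Y ⟧)
tryStep (s · t) with tryStep s
... | just (s' , st) = just (s' · t , stepAppL st)
... | nothing with tryStep t
...   | just (t' , st) = just (s · t' , stepAppR st)
...   | nothing        = tryβ s t
tryStep _ = nothing

evaluate : ℕ → (X : Tm) → Σ[ Y ∈ Tm ] ⟦ X ⟧ ≻* ⟦ Y ⟧
evaluate zero    X = X , refl*
evaluate (suc n) X with tryStep X
... | nothing       = X , refl*
... | just (Y , st) = let Z , r = evaluate n Y in Z , step* st r

-- Closed reduction facts are proved by running the evaluator: Agda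
-- normalises the result and compares it with the claimed reduct.
run : ∀ n X → ⟦ X ⟧ ≻* ⟦ proj₁ (evaluate n X) ⟧
run n X = proj₂ (evaluate n X)

compute : ∀ X → ⟦ X ⟧ ≻* ⟦ proj₁ (evaluate 50 X) ⟧
compute = run 50

-- Scott numerals  0 = λz s. z,  1+i = λz s. s ⌜i⌝,  and the identity I.
I : Val
I = abs (v 0) tt

encN : ℕ → Val
encN zero    = abs (ƛ (v 1)) tt
encN (suc i) = abs (ƛ (v 0 · ⟨ encN i ⟩)) tt

-- caseC (b₀ ∷ b₁ ∷ …) maps the numeral i to bᵢ (numerals beyond the list
-- are returned unchanged); the recursive call is frozen, so that the
-- correctness proof proceeds by induction on the list.
caseC : List Val → Val
caseC []       = I
caseC (b ∷ bs) = abs (v 0 · ⟨ b ⟩ · ⟪ caseC bs ⟫) tt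

select : List Val → ℕ → Val
select []       i       = encN i
select (b ∷ bs) zero    = b
select (b ∷ bs) (suc i) = select bs i

caseC-correct : ∀ bs i → ⟦ ⟨ caseC bs ⟩ · ⟨ encN i ⟩ ⟧ ≻* ⟦ ⟨ select bs i ⟩ ⟧
caseC-correct []       i       = run 5 (⟨ caseC [] ⟩ · ⟨ encN i ⟩)
caseC-correct (b ∷ bs) zero    = run 5 (⟨ caseC (b ∷ bs) ⟩ · ⟨ encN zero ⟩)
caseC-correct (b ∷ bs) (suc i) =
  ≻*-trans (run 5 (⟨ caseC (b ∷ bs) ⟩ · ⟨ encN (suc i) ⟩)) (caseC-correct bs i)

-- Elements of a finite type are encoded by their position in its
-- enumeration; a case analysis over the enumeration then recovers them.
position : {X : Set} {x : X} {xs : List X} → x ∈ xs → ℕ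
position x∈xs = toℕ (index x∈xs)

select-position : ∀ {X : Set} (g : X → Val) {x xs} (x∈xs : x ∈ xs) →
                  select (map g xs) (position x∈xs) ≡ g x
select-position g (here refl)  = refl
select-position g (there x∈xs) = select-position g x∈xs

caseC-position : ∀ {X : Set} (g : X → Val) {x xs} (x∈xs : x ∈ xs) →
                 ⟦ ⟨ caseC (map g xs) ⟩ · ⟨ encN (position x∈xs) ⟩ ⟧ ≻* ⟦ ⟨ g x ⟩ ⟧
caseC-position g {xs = xs} x∈xs rewrite sym (select-position g x∈xs) =
  caseC-correct (map g xs) (position x∈xs)

module Encoding (Σ' : FinType) where
  A : Set
  A = Carrier Σ'

  code : Maybe A → ℕ
  code nothing  = 0
  code (just a) = suc (position (complete Σ' a))

  -- Scott encodings: a list is  λn c. n  or  λn c. c x xs;  a tape is a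
  -- four-way case with the constructors in the order of  Tape;  a vector
  -- of tapes is  I  or  λp. p t ts.
  encSym : A → Val
  encSym a = encN (code (just a))

  encL : List A → Val
  encL []       = abs (ƛ (v 1)) tt
  encL (x ∷ xs) = abs (ƛ (v 0 · ⟨ encSym x ⟩ · ⟨ encL xs ⟩)) tt

  encT : Tape A → Val
  encT niltape         = abs (ƛ (ƛ (ƛ (v 3)))) tt
  encT (leftof a rs)   = abs (ƛ (ƛ (ƛ (v 2 · ⟨ encSym a ⟩ · ⟨ encL rs ⟩)))) tt
  encT (rightof a ls)  = abs (ƛ (ƛ (ƛ (v 1 · ⟨ encSym a ⟩ · ⟨ encL ls ⟩)))) tt
  encT (midtape l a r) = abs (ƛ (ƛ (ƛ (v 0 · ⟨ encL l ⟩ · ⟨ encSym a ⟩ · ⟨ encL r ⟩)))) tt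

  encV : ∀ {m} → Vec (Tape A) m → Val
  encV []       = I
  encV (t ∷ ts) = abs (v 0 · ⟨ encT t ⟩ · ⟨ encV ts ⟩) tt

  nilC consC niltapeC leftofC rightofC midtapeC vconsC : Val
  nilC     = encL []
  consC    = abs (ƛ (ƛ (ƛ (v 0 · v 3 · v 2)))) tt
  niltapeC = encT niltape
  leftofC  = abs (ƛ (ƛ (ƛ (ƛ (ƛ (v 2 · v 5 · v 4)))))) tt
  rightofC = abs (ƛ (ƛ (ƛ (ƛ (ƛ (v 1 · v 5 · v 4)))))) tt
  midtapeC = abs (ƛ (ƛ (ƛ (ƛ (ƛ (ƛ (v 0 · v 6 · v 5 · v 4))))))) tt
  vconsC   = abs (ƛ (ƛ (v 0 · v 2 · v 1))) tt

  writeC : Maybe A → Val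
  writeC nothing  = I
  writeC (just s) = abs (v 0 · ⟨ encT (midtape [] s []) ⟩ · ⟨ onLeftof ⟩ · ⟨ onRightof ⟩ · ⟨ onMidtape ⟩) tt
    where
    onLeftof  = abs (ƛ (⟨ midtapeC ⟩ · ⟨ nilC ⟩ · ⟨ encSym s ⟩ · (⟨ consC ⟩ · v 1 · v 0))) tt
    onRightof = abs (ƛ (⟨ midtapeC ⟩ · (⟨ consC ⟩ · v 1 · v 0) · ⟨ encSym s ⟩ · ⟨ nilC ⟩)) tt
    onMidtape = abs (ƛ (ƛ (⟨ midtapeC ⟩ · v 2 · ⟨ encSym s ⟩ · v 0))) tt

  moveC : Move → Val
  moveC N = I
  moveC R = abs (v 0 · ⟨ niltapeC ⟩ · ⟨ onLeftof ⟩ · ⟨ onRightof ⟩ · ⟨ onMidtape ⟩) tt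
    where
    onLeftof  = abs (ƛ (⟨ midtapeC ⟩ · ⟨ nilC ⟩ · v 1 · v 0)) tt
    onRightof = abs (ƛ (⟨ rightofC ⟩ · v 1 · v 0)) tt
    atEnd     = abs (ƛ (⟨ rightofC ⟩ · v 0 · v 1)) tt
    shift     = abs (ƛ (ƛ (ƛ (⟨ midtapeC ⟩ · (⟨ consC ⟩ · v 0 · v 1) · v 3 · v 2)))) tt
    onMidtape = abs (ƛ (ƛ (v 0 · ⟨ atEnd ⟩ · ⟨ shift ⟩ · v 2 · v 1))) tt
  moveC L = abs (v 0 · ⟨ niltapeC ⟩ · ⟨ onLeftof ⟩ · ⟨ onRightof ⟩ · ⟨ onMidtape ⟩) tt
    where
    onLeftof  = abs (ƛ (⟨ leftofC ⟩ · v 1 · v 0)) tt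
    onRightof = abs (ƛ (⟨ midtapeC ⟩ · v 0 · v 1 · ⟨ nilC ⟩)) tt
    atEnd     = abs (ƛ (⟨ leftofC ⟩ · v 1 · v 0)) tt
    shift     = abs (ƛ (ƛ (ƛ (⟨ midtapeC ⟩ · v 2 · v 3 · (⟨ consC ⟩ · v 1 · v 0))))) tt
    onMidtape = abs (ƛ (ƛ (v 2 · ⟨ atEnd ⟩ · ⟨ shift ⟩ · v 1 · v 0))) tt

  writeC-correct : ∀ w t → ⟦ ⟨ writeC w ⟩ · ⟨ encT t ⟩ ⟧ ≻* ⟦ ⟨ encT (tape-write t w) ⟩ ⟧
  writeC-correct nothing  t               = compute (⟨ writeC nothing ⟩ · ⟨ encT t ⟩)
  writeC-correct (just s) niltape         = compute (⟨ writeC (just s) ⟩ · ⟨ encT niltape ⟩)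
  writeC-correct (just s) (leftof a rs)   = compute (⟨ writeC (just s) ⟩ · ⟨ encT (leftof a rs) ⟩)
  writeC-correct (just s) (rightof a ls)  = compute (⟨ writeC (just s) ⟩ · ⟨ encT (rightof a ls) ⟩)
  writeC-correct (just s) (midtape l a r) = compute (⟨ writeC (just s) ⟩ · ⟨ encT (midtape l a r) ⟩)

  moveC-correct : ∀ m t → ⟦ ⟨ moveC m ⟩ · ⟨ encT t ⟩ ⟧ ≻* ⟦ ⟨ encT (tape-move t m) ⟩ ⟧
  moveC-correct N t                       = compute (⟨ moveC N ⟩ · ⟨ encT t ⟩)
  moveC-correct R niltape                 = compute (⟨ moveC R ⟩ · ⟨ encT niltape ⟩)
  moveC-correct R (leftof a rs)           = compute (⟨ moveC R ⟩ · ⟨ encT (leftof a rs) ⟩)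
  moveC-correct R (rightof a ls)          = compute (⟨ moveC R ⟩ · ⟨ encT (rightof a ls) ⟩)
  moveC-correct R (midtape l a [])        = compute (⟨ moveC R ⟩ · ⟨ encT (midtape l a []) ⟩)
  moveC-correct R (midtape l a (r ∷ rs))  = compute (⟨ moveC R ⟩ · ⟨ encT (midtape l a (r ∷ rs)) ⟩)
  moveC-correct L niltape                 = compute (⟨ moveC L ⟩ · ⟨ encT niltape ⟩)
  moveC-correct L (leftof a rs)           = compute (⟨ moveC L ⟩ · ⟨ encT (leftof a rs) ⟩)
  moveC-correct L (rightof a ls)          = compute (⟨ moveC L ⟩ · ⟨ encT (rightof a ls) ⟩)
  moveC-correct L (midtape [] a r)        = compute (⟨ moveC L ⟩ · ⟨ encT (midtape [] a r) ⟩)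
  moveC-correct L (midtape (l ∷ ls) a r)  = compute (⟨ moveC L ⟩ · ⟨ encT (midtape (l ∷ ls) a r) ⟩)

  doActC : Maybe A × Move → Val
  doActC (w , m) = abs (⟪ moveC m ⟫ · (⟪ writeC w ⟫ · v 0)) tt

  doActC-correct : ∀ a t → ⟦ ⟨ doActC a ⟩ · ⟨ encT t ⟩ ⟧ ≻* ⟦ ⟨ encT (doAct t a) ⟩ ⟧
  doActC-correct (w , m) t =
    ≻*-trans (compute (⟨ doActC (w , m) ⟩ · ⟨ encT t ⟩))
      (≻*-trans (≻*-appʳ (writeC-correct w t)) (moveC-correct m (tape-write t w)))

  doActsC : ∀ {m} → Vec (Maybe A × Move) m → Val
  doActsC []       = I
  doActsC (a ∷ as) = abs (v 0 · ⟨ onCons ⟩) tt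
    where
    onCons = abs (ƛ (⟨ vconsC ⟩ · (⟪ doActC a ⟫ · v 1) · (⟪ doActsC as ⟫ · v 0))) tt

  doActsC-correct : ∀ {m} (as : Vec (Maybe A × Move) m) ts →
                    ⟦ ⟨ doActsC as ⟩ · ⟨ encV ts ⟩ ⟧ ≻* ⟦ ⟨ encV (zipWith doAct ts as) ⟩ ⟧
  doActsC-correct []       []       = compute (⟨ doActsC [] ⟩ · ⟨ encV [] ⟩)
  doActsC-correct (a ∷ as) (t ∷ ts) =
    ≻*-trans (compute (⟨ doActsC (a ∷ as) ⟩ · ⟨ encV (t ∷ ts) ⟩))
    (≻*-trans (≻*-appˡ (≻*-appʳ (doActC-correct a t)))
    (≻*-trans (≻*-appʳ (doActsC-correct as ts))
      (compute (⟨ vconsC ⟩ · ⟨ encT (doAct t a) ⟩ · ⟨ encV (zipWith doAct ts as) ⟩))))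

  currentC : Val
  currentC = abs (v 0 · ⟨ encN 0 ⟩ · ⟨ constNone ⟩ · ⟨ constNone ⟩ · ⟨ onMidtape ⟩) tt
    where
    constNone = abs (ƛ ⟨ encN 0 ⟩) tt
    onMidtape = abs (ƛ (ƛ (v 1))) tt

  currentC-correct : ∀ t → ⟦ ⟨ currentC ⟩ · ⟨ encT t ⟩ ⟧ ≻* ⟦ ⟨ encN (code (current t)) ⟩ ⟧
  currentC-correct niltape         = compute (⟨ currentC ⟩ · ⟨ encT niltape ⟩)
  currentC-correct (leftof a rs)   = compute (⟨ currentC ⟩ · ⟨ encT (leftof a rs) ⟩)
  currentC-correct (rightof a ls)  = compute (⟨ currentC ⟩ · ⟨ encT (rightof a ls) ⟩)
  currentC-correct (midtape l a r) = compute (⟨ currentC ⟩ · ⟨ encT (midtape l a r) ⟩)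

  branches : (Maybe A → Val) → List Val
  branches f = f nothing ∷ map (λ a → f (just a)) (enum Σ')

  select-branches : ∀ f r → select (branches f) (code r) ≡ f r
  select-branches f nothing  = refl
  select-branches f (just a) = select-position (λ a → f (just a)) (complete Σ' a)

  caseC-branches : ∀ f r → ⟦ ⟨ caseC (branches f) ⟩ · ⟨ encN (code r) ⟩ ⟧ ≻* ⟦ ⟨ f r ⟩ ⟧
  caseC-branches f r rewrite sym (select-branches f r) = caseC-correct (branches f) (code r)

  -- Reading all m current symbols and passing them, as an Agda vector, to
  -- a family of continuations k; the read vector selects the branch.
  readC : ∀ m → (Vec (Maybe A) m → Val) → Val
  readC zero    k = abs ⟪ k [] ⟫ tt
  readC (suc m) k = abs (ƛ (v 1 · ⟨ onCons ⟩ · v 0)) tt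
    where
    rest   = λ r → readC m (λ rs → k (r ∷ rs))
    onCons = abs (ƛ (ƛ (⟪ caseC (branches rest) ⟫ · (⟪ currentC ⟫ · v 2) · v 1 · v 0))) tt

  readC-correct : ∀ m k (ts : Vec (Tape A) m) X →
                  ⟦ ⟨ readC m k ⟩ · ⟨ encV ts ⟩ · ⟨ X ⟩ ⟧ ≻* ⟦ ⟨ k (vmap current ts) ⟩ · ⟨ X ⟩ ⟧
  readC-correct zero    k []       X = compute (⟨ readC zero k ⟩ · ⟨ encV [] ⟩ · ⟨ X ⟩)
  readC-correct (suc m) k (t ∷ ts) X =
    ≻*-trans (compute (⟨ readC (suc m) k ⟩ · ⟨ encV (t ∷ ts) ⟩ · ⟨ X ⟩))
    (≻*-trans (≻*-appˡ (≻*-appˡ (≻*-appʳ (currentC-correct t))))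
    (≻*-trans (≻*-appˡ (≻*-appˡ (caseC-branches rest (current t))))
      (readC-correct m (λ rs → k (current t ∷ rs)) ts X)))
    where
    rest : Maybe A → Val
    rest r = readC m (λ rs → k (r ∷ rs))

module Simulation (Σ' : FinType) (n : ℕ) (M : TM Σ' n) where
  open Encoding Σ'

  Q : FinType
  Q = states M

  encState : Carrier Q → Val
  encState q = encN (position (complete Q q))

  encConf : Conf M → Val
  encConf (q , ts) = abs (v 0 · ⟨ encState q ⟩ · ⟨ encV ts ⟩) tt

  -- Scott-encoded options of configurations: none = λn s. n, some c = λn s. s c.
  none : Val
  none = abs (ƛ (v 1)) tt

  some : Val → Val
  some c = abs (ƛ (v 0 · ⟨ c ⟩)) tt

  someC confC : Val
  someC = abs (ƛ (ƛ (v 0 · v 2))) tt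
  confC = abs (ƛ (ƛ (v 0 · v 2 · v 1))) tt

  someConfC : Carrier Q → Val
  someConfC q' = abs (⟨ someC ⟩ · (⟨ confC ⟩ · ⟨ encState q' ⟩ · v 0)) tt

  transitionC : Carrier Q × Vec (Maybe A × Move) n → Val
  transitionC (q' , acts) = abs (⟨ someConfC q' ⟩ · (⟪ doActsC acts ⟫ · v 0)) tt

  transitionC-correct : ∀ r ts → ⟦ ⟨ transitionC r ⟩ · ⟨ encV ts ⟩ ⟧
                                 ≻* ⟦ ⟨ some (encConf (proj₁ r , zipWith doAct ts (proj₂ r))) ⟩ ⟧
  transitionC-correct (q' , acts) ts =
    ≻*-trans (compute (⟨ transitionC (q' , acts) ⟩ · ⟨ encV ts ⟩))
    (≻*-trans (≻*-appʳ (doActsC-correct acts ts))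
      (compute (⟨ someConfC q' ⟩ · ⟨ encV (zipWith doAct ts acts) ⟩)))

  -- The behaviour in state q, given the tapes twice (once to read them,
  -- once to act on them): halting states answer none, the others read the
  -- current symbols and perform the transition.
  haltedC : Val
  haltedC = abs (ƛ ⟨ none ⟩) tt

  runningC : Carrier Q → Val
  runningC q = readC n (λ rs → transitionC (trans M (q , rs)))

  stateC : Carrier Q → Val
  stateC q = if halt M q then haltedC else runningC q

  stateC-halting : ∀ q → halt M q ≡ true → stateC q ≡ haltedC
  stateC-halting q halted rewrite halted = refl

  stateC-running : ∀ q → halt M q ≡ false → stateC q ≡ runningC q
  stateC-running q running rewrite running = refl

  stepC : Val
  stepC = abs (v 0 · ⟨ dispatch ⟩) tt
    where
    dispatch = abs (ƛ (⟪ caseC (map stateC (enum Q)) ⟫ · v 1 · v 0 · v 0)) tt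

  stepC-dispatch : ∀ q ts {c} → stateC q ≡ c →
                   ⟦ ⟨ stepC ⟩ · ⟨ encConf (q , ts) ⟩ ⟧ ≻* ⟦ ⟨ c ⟩ · ⟨ encV ts ⟩ · ⟨ encV ts ⟩ ⟧
  stepC-dispatch q ts refl =
    ≻*-trans (compute (⟨ stepC ⟩ · ⟨ encConf (q , ts) ⟩))
      (≻*-appˡ (≻*-appˡ (caseC-position stateC (complete Q q))))

  stepC-halting : ∀ q ts → halt M q ≡ true → ⟦ ⟨ stepC ⟩ · ⟨ encConf (q , ts) ⟩ ⟧ ≻* ⟦ ⟨ none ⟩ ⟧
  stepC-halting q ts halted =
    ≻*-trans (stepC-dispatch q ts (stateC-halting q halted))
      (compute (⟨ haltedC ⟩ · ⟨ encV ts ⟩ · ⟨ encV ts ⟩))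

  stepC-running : ∀ q ts → halt M q ≡ false →
                  ⟦ ⟨ stepC ⟩ · ⟨ encConf (q , ts) ⟩ ⟧ ≻* ⟦ ⟨ some (encConf (step M (q , ts))) ⟩ ⟧
  stepC-running q ts running =
    ≻*-trans (stepC-dispatch q ts (stateC-running q running))
    (≻*-trans (readC-correct n (λ rs → transitionC (trans M (q , rs))) ts (encV ts))
      (transitionC-correct (trans M (q , vmap current ts)) ts))

  -- A round:  D D ⌜c⌝  unfolds to  stepC ⌜c⌝ I (λx. D D x),  which on none
  -- returns I and on some ⌜c'⌝ continues with  D D ⌜c'⌝.
  loopBody : Tm
  loopBody = ƛ (⟪ stepC ⟫ · v 0 · ⟨ I ⟩ · ƛ (v 2 · v 2 · v 0))

  D : Val
  D = abs loopBody tt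

  haltTerm : Conf M → Term
  haltTerm c = ⟦ ⟨ D ⟩ · ⟨ D ⟩ · ⟨ encConf c ⟩ ⟧

  recurse : Tm
  recurse = ƛ (⟨ D ⟩ · ⟨ D ⟩ · v 0)

  unfolded : Conf M → Tm
  unfolded c = substT loopBody 0 ⟨ D ⟩ · ⟨ encConf c ⟩

  unfold : ∀ c → haltTerm c ≻ ⟦ unfolded c ⟧
  unfold c = stepAppL (β-template loopBody ⟨ D ⟩ refl)

  -- The rounds from a halting and from a non-halting configuration; the
  -- latter stops after exactly three steps, before the next unfolding.
  round-halting : ∀ q ts → halt M q ≡ true → haltTerm (q , ts) ≻* ⟦ ⟨ I ⟩ ⟧
  round-halting q ts halted =
    step* (unfold (q , ts))
    (≻*-trans (compute (unfolded (q , ts)))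
    (≻*-trans (≻*-appˡ (≻*-appˡ (stepC-halting q ts halted)))
      (compute (⟨ none ⟩ · ⟨ I ⟩ · recurse))))

  round-running : ∀ q ts → halt M q ≡ false → ⟦ unfolded (q , ts) ⟧ ≻* haltTerm (step M (q , ts))
  round-running q ts running =
    ≻*-trans (compute (unfolded (q , ts)))
    (≻*-trans (≻*-appˡ (≻*-appˡ (stepC-running q ts running)))
      (run 3 (⟨ some (encConf (step M (q , ts))) ⟩ · ⟨ I ⟩ · recurse)))

  HaltsFrom : Conf M → Set
  HaltsFrom c = Σ[ c' ∈ Conf M ] Σ[ k ∈ ℕ ] (halt M (proj₁ c') ≡ true) × (loopM M c k ≡ just c')

  halts⇒reducesToI : ∀ k c {c'} → loopM M c k ≡ just c' → haltTerm c ≻* ⟦ ⟨ I ⟩ ⟧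
  halts⇒reducesToI k (q , ts) result with halt M q in eq
  ... | true = round-halting q ts eq
  halts⇒reducesToI zero    (q , ts) () | false
  halts⇒reducesToI (suc k) (q , ts) result | false =
    step* (unfold (q , ts))
      (≻*-trans (round-running q ts eq) (halts⇒reducesToI k (step M (q , ts)) result))

  halts⇒terminates : ∀ c → HaltsFrom c → E (haltTerm c)
  halts⇒terminates c (_ , k , _ , result) = _ , halts⇒reducesToI k c result , _ , refl

  -- Completeness: if haltTerm c reaches an abstraction in n steps, each
  -- non-halting round strictly decreases n, so the machine halts from c.
  normalises⇒halts : ∀ fuel c {b n} → n ≤ fuel → haltTerm c ≻[ n ] lam b → HaltsFrom c
  normalises⇒halts zero c z≤n ()
  normalises⇒halts (suc fuel) (q , ts) {b} n≤fuel r with halt M q in eq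
  ... | true  = (q , ts) , 0 , eq , refl
  ... | false with properReductToNormal (lam-normal b) r (unfold (q , ts)) (round-running q ts eq)
  ...   | m , m<n , r' with normalises⇒halts fuel (step M (q , ts)) (s≤s⁻¹ (<-≤-trans m<n n≤fuel)) r'
  ...     | c' , k , halted , result = c' , suc k , halted , result

  terminates⇒halts : ∀ c → E (haltTerm c) → HaltsFrom c
  terminates⇒halts c (_ , p , b , refl) =
    let n , r = countSteps p in normalises⇒halts n c ≤-refl r

haltingTerm : HaltInstance → Term
haltingTerm (Σ' , n , M , tp) = Simulation.haltTerm Σ' n M (start M , tp)

mainTheorem5 : Σ[ g ∈ (HaltInstance → Term) ] (∀ x → (Halt x → E (g x)) × (E (g x) → Halt x))
mainTheorem5 = haltingTerm , correct
  where
  correct : ∀ x → (Halt x → E (haltingTerm x)) × (E (haltingTerm x) → Halt x)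
  correct (Σ' , n , M , tp) = halts⇒terminates (start M , tp) , terminates⇒halts (start M , tp)
    where open Simulation Σ' n M
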